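{- Let $\mathbf A$ be a complete residuated lattice and $I$, $J$ arbitrary sets. (i) A mapping $\phi\colon A^I\to A^J$ is a $\phi$-type mapping if and only if there is a fuzzy relation $R\colon I\times J\to A$ with $\phi=\phi_R$; a mapping $\rho\colon A^J\to A^I$ is a $\rho$-type mapping if and only if there is a fuzzy relation $R\colon I\times J\to A$ with $\rho=\rho_R$. Moreover, a $\phi$-type mapping $\phi$ and a $\rho$-type mapping $\rho$ form a Galois connection between $A^I$ and $A^J$ if and only if there is a single fuzzy relation $R$ with $\phi=\phi_R$ and $\rho=\rho_R$. (ii) A mapping $\delta\colon A^I\to A^J$ is a $\delta$-type mapping if and only if $\delta=\delta_R$ for some fuzzy relation $R\colon I\times J\to A$; a mapping $\epsilon\colon A^J\to A^I$ is a $\delta$-type mapping if and only if $\epsilon=\epsilon_R$ for some fuzzy relation $R\colon I\times J\to A$. Moreover, $\delta$-type mappings $\delta\colon A^I\to A^J$ and $\epsilon\colon A^J\to A^I$ form a reversed Galois connection if and only if there is a single fuzzy relation $R$ with $\delta=\delta_R$ and $\epsilon=\epsilon_R$.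
   Context: A residuated lattice is an algebra $\mathbf A=(A;\vee,\wedge,\cdot,\rightarrow,0,1)$ such that $(A;\vee,\wedge,0,1)$ is a bounded lattice, $(A;\cdot,1)$ is a commutative monoid, and $x\cdot y\le z$ iff $x\le y\rightarrow z$; complete if the lattice reduct is complete. $A^K$ carries componentwise operations and order; $d^K$ is the constant element with value $d\in A$. A fuzzy relation is a map $R\colon I\times J\to A$. Operators: $\phi_R(x)(j)=\bigwedge_{i\in I}(R(i,j)\rightarrow x(i))$ ($A^I\to A^J$); $\rho_R(y)(i)=\bigvee_{j\in J}(R(i,j)\cdot y(j))$ ($A^J\to A^I$); $\delta_R(x)(j)=\bigwedge_{i\in I}(x(i)\rightarrow R(i,j))$ ($A^I\to A^J$); $\epsilon_R(y)(i)=\bigwedge_{j\in J}(y(j)\rightarrow R(i,j))$ ($A^J\to A^I$). Galois connection: monotone $\phi,\rho$ with $y\le\phi(x)$ iff $\rho(y)\le x$. Reversed Galois connection: antitone $\delta,\epsilon$ with $y\le\delta(x)$ iff $x\le\epsilon(y)$. For sets $K,L$: $\phi\colon A^K\to A^L$ is $\phi$-type if infima preserving ($\phi(\bigwedge M)=\bigwedge\phi(M)$ for all $M$) and $d^L\rightarrow\phi(x)=\phi(d^K\rightarrow x)$ for all $d\in A$; $\rho\colon A^L\to A^K$ is $\rho$-type if suprema preserving and $d^K\cdot\rho(x)=\rho(d^L\cdot x)$ for all $d$; $\delta\colon A^K\to A^L$ is $\delta$-type if suprema reversing ($\delta(\bigvee M)=\bigwedge\delta(M)$) and $d^L\rightarrow\delta(x)=\delta(d^K\cdot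 x)$ for all $d$. -}

module Defs where

open import Algebra.Core using (Op₂)
open import Algebra.Structures using (IsCommutativeMonoid)
open import Data.Product.Base using (_×_; _,_; ∃; proj₁; proj₂)
open import Function.Base using (const; flip)
open import Function.Bundles using (Func; _⟨$⟩_; _⇔_)
open import Level using (Level; _⊔_; suc)
open import Relation.Binary.Bundles using (Setoid)
open import Relation.Binary.Core using (Rel)
open import Relation.Binary.Definitions using (Monotonic₁; Antitonic₁)
open import Relation.Binary.Lattice using (IsBoundedLattice; Exponential)
open import Relation.Unary using (Pred; _∈_)
import Algebra.Construct.Pointwise as Pointwise

IsLeastUpperBound : ∀ {a r p} {A : Set a} → Rel A r → Pred A p → A → Set _
IsLeastUpperBound _≤_ P s =
  (∀ x → x ∈ P → x ≤ s) × (∀ z → (∀ x → x ∈ P → x ≤ z) → s ≤ z)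

IsGreatestLowerBound : ∀ {a r p} {A : Set a} → Rel A r → Pred A p → A → Set _
IsGreatestLowerBound _≤_ = IsLeastUpperBound (flip _≤_)

record ResiduatedLattice c ℓ₁ ℓ₂ : Set (suc (c ⊔ ℓ₁ ⊔ ℓ₂)) where
  infix  4 _≈_ _≤_
  infixr 5 _⇨_
  infixr 6 _∨_
  infixr 7 _∧_
  infixl 8 _·_
  field
    Carrier : Set c
    _≈_     : Rel Carrier ℓ₁
    _≤_     : Rel Carrier ℓ₂
    _∨_     : Op₂ Carrier
    _∧_     : Op₂ Carrier
    _·_     : Op₂ Carrier
    _⇨_     : Op₂ Carrier
    0#      : Carrier
    1#      : Carrier

    isBoundedLattice      : IsBoundedLattice _≈_ _≤_ _∨_ _∧_ 1# 0#
    ·-isCommutativeMonoid : IsCommutativeMonoid _≈_ _·_ 1#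
    -- Despite its name, `Exponential` may be used with any operation in place
    -- of the meet: here it says that x · y ≤ z iff x ≤ y ⇨ z.
    residuation           : Exponential _≤_ _·_ _⇨_

  open IsBoundedLattice isBoundedLattice public

-- "Set" and "subset" mean `Set ℓ` and `Pred _ ℓ`, for one fixed but arbitrary
-- universe level ℓ.  A subset is not required to respect _≈_: it has the same
-- bounds as its closure under _≈_.
record CompleteResiduatedLattice ℓ : Set (suc ℓ) where
  field
    residuatedLattice : ResiduatedLattice ℓ ℓ ℓ

  open ResiduatedLattice residuatedLattice public

  field
    ⋁            : Pred Carrier ℓ → Carrier
    ⋀            : Pred Carrier ℓ → Carrier
    ⋁-isSupremum : ∀ P → IsLeastUpperBound _≤_ P (⋁ P)
    ⋀-isInfimum  : ∀ P → IsGreatestLowerBound _≤_ P (⋀ P)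

module FuzzyRelations {ℓ : Level} (𝐀 : CompleteResiduatedLattice ℓ) where
  open CompleteResiduatedLattice 𝐀

  private
    variable
      I J K L : Set ℓ

  ⋁[] : (K → Carrier) → Carrier
  ⋁[] f = ⋁ (λ a → ∃ λ k → f k ≈ a)

  ⋀[] : (K → Carrier) → Carrier
  ⋀[] f = ⋀ (λ a → ∃ λ k → f k ≈ a)

  syntax ⋁[] (λ k → e) = ⋁[ k ] e
  syntax ⋀[] (λ k → e) = ⋀[ k ] e

  infix 30 A^_
  A^_ : Set ℓ → Setoid ℓ ℓ
  A^ K = record
    { Carrier       = K → Carrier
    ; _≈_           = λ x y → ∀ k → x k ≈ y k
    ; isEquivalence = Pointwise.isEquivalence K isEquivalence
    }

  infix  4 _≈̇_ _≤̇_
  infixr 5 _⇨̇_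
  infixl 8 _·̇_

  _≈̇_ : Rel (K → Carrier) ℓ
  x ≈̇ y = ∀ k → x k ≈ y k

  _≤̇_ : Rel (K → Carrier) ℓ
  x ≤̇ y = ∀ k → x k ≤ y k

  _·̇_ : Op₂ (K → Carrier)
  (x ·̇ y) k = x k · y k

  _⇨̇_ : Op₂ (K → Carrier)
  (x ⇨̇ y) k = x k ⇨ y k

  ⋁̇ : Pred (K → Carrier) ℓ → (K → Carrier)
  ⋁̇ M k = ⋁ (λ a → ∃ λ x → x ∈ M × x k ≈ a)

  ⋀̇ : Pred (K → Carrier) ℓ → (K → Carrier)
  ⋀̇ M k = ⋀ (λ a → ∃ λ x → x ∈ M × x k ≈ a)

  ⋁̇-isSupremum : (M : Pred (K → Carrier) ℓ) → IsLeastUpperBound _≤̇_ M (⋁̇ M)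
  ⋁̇-isSupremum M =
    (λ x x∈M k → proj₁ (⋁-isSupremum _) _ (x , x∈M , Eq.refl)) ,
    (λ z M≤z k → proj₂ (⋁-isSupremum _) _
      (λ { _ (x , x∈M , xk≈a) → trans (reflexive (Eq.sym xk≈a)) (M≤z x x∈M k) }))

  ⋀̇-isInfimum : (M : Pred (K → Carrier) ℓ) → IsGreatestLowerBound _≤̇_ M (⋀̇ M)
  ⋀̇-isInfimum M =
    (λ x x∈M k → proj₁ (⋀-isInfimum _) _ (x , x∈M , Eq.refl)) ,
    (λ z z≤M k → proj₂ (⋀-isInfimum _) _
      (λ { _ (x , x∈M , xk≈a) → trans (z≤M x x∈M k) (reflexive xk≈a) }))

  -- Elements of A^K are functions compared pointwise, so a mapping is one that
  -- respects pointwise equality.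
  Mapping : Set ℓ → Set ℓ → Set ℓ
  Mapping K L = Func (A^ K) (A^ L)

  infix 4 _≐_
  _≐_ : Mapping K L → ((K → Carrier) → (L → Carrier)) → Set ℓ
  f ≐ g = ∀ x → f ⟨$⟩ x ≈̇ g x

  image : Mapping K L → Pred (K → Carrier) ℓ → Pred (L → Carrier) ℓ
  image f M y = ∃ λ x → x ∈ M × f ⟨$⟩ x ≈̇ y

  FuzzyRelation : Set ℓ → Set ℓ → Set ℓ
  FuzzyRelation I J = I → J → Carrier

  φ[_] : FuzzyRelation I J → (I → Carrier) → (J → Carrier)
  φ[ R ] x j = ⋀[ i ] (R i j ⇨ x i)

  ρ[_] : FuzzyRelation I J → (J → Carrier) → (I → Carrier)
  ρ[ R ] y i = ⋁[ j ] (R i j · y j)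

  δ[_] : FuzzyRelation I J → (I → Carrier) → (J → Carrier)
  δ[ R ] x j = ⋀[ i ] (x i ⇨ R i j)

  ε[_] : FuzzyRelation I J → (J → Carrier) → (I → Carrier)
  ε[ R ] y i = ⋀[ j ] (y j ⇨ R i j)

  record IsGaloisConnection (φ : Mapping I J) (ρ : Mapping J I) : Set ℓ where
    field
      φ-monotone : Monotonic₁ _≤̇_ _≤̇_ (φ ⟨$⟩_)
      ρ-monotone : Monotonic₁ _≤̇_ _≤̇_ (ρ ⟨$⟩_)
      adjoint    : ∀ x y → y ≤̇ φ ⟨$⟩ x ⇔ ρ ⟨$⟩ y ≤̇ x

  record IsReversedGaloisConnection (δ : Mapping I J) (ε : Mapping J I) : Set ℓ where
    field
      δ-antitone : Antitonic₁ _≤̇_ _≤̇_ (δ ⟨$⟩_)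
      ε-antitone : Antitonic₁ _≤̇_ _≤̇_ (ε ⟨$⟩_)
      adjoint    : ∀ x y → y ≤̇ δ ⟨$⟩ x ⇔ x ≤̇ ε ⟨$⟩ y

  record Isφ-Type (φ : Mapping K L) : Set (suc ℓ) where
    field
      preserves-⋀ : ∀ M → φ ⟨$⟩ (⋀̇ M) ≈̇ ⋀̇ (image φ M)
      commutes-⇨  : ∀ d x → const d ⇨̇ (φ ⟨$⟩ x) ≈̇ φ ⟨$⟩ (const d ⇨̇ x)

  record Isρ-Type (ρ : Mapping L K) : Set (suc ℓ) where
    field
      preserves-⋁ : ∀ M → ρ ⟨$⟩ (⋁̇ M) ≈̇ ⋁̇ (image ρ M)
      commutes-·  : ∀ d x → const d ·̇ (ρ ⟨$⟩ x) ≈̇ ρ ⟨$⟩ (const d ·̇ x)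

  record Isδ-Type (δ : Mapping K L) : Set (suc ℓ) where
    field
      reverses-⋁ : ∀ M → δ ⟨$⟩ (⋁̇ M) ≈̇ ⋀̇ (image δ M)
      exchanges  : ∀ d x → const d ⇨̇ (δ ⟨$⟩ x) ≈̇ δ ⟨$⟩ (const d ·̇ x)

{-# OPTIONS --safe #-}
module Submission where

-- The columns of the representing relation are read off the mapping: a column
-- of R is the least x with 1 ≤ φ(x)(j), respectively the greatest x with
-- 1 ≤ δ(x)(j).  Commutation with constants reduces a comparison d ≤ φ(x)(j) to
-- 1 ≤ φ(d → x)(j), so these x determine the mapping.  A ρ-type mapping is
-- determined by its values on singletons, since y is the supremum of the
-- multiples y(j) · {j}.  In both Galois correspondences the second mapping is
-- then forced by uniqueness of adjoints.

open import Defs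
open import Algebra.Structures using (IsCommutativeMonoid)
open import Data.Product.Base using (_×_; _,_; ∃; proj₁; proj₂)
open import Function.Base using (const; flip)
open import Function.Bundles using (_⇔_; mk⇔; Equivalence; _⟨$⟩_; Func)
open import Level using (Level)
open import Relation.Binary.Definitions using (Monotonic₁; Antitonic₁)
open import Relation.Binary.PropositionalEquality.Core using (_≡_; refl)
open import Relation.Unary using (Pred; _∈_)

open Equivalence using (to; from)

module Representation {ℓ : Level} (𝐀 : CompleteResiduatedLattice ℓ) where
  open CompleteResiduatedLattice 𝐀 renaming (refl to ≤-refl; reflexive to ≈⇒≤)
  open FuzzyRelations 𝐀
  open IsCommutativeMonoid ·-isCommutativeMonoid
    using (assoc; comm; identityˡ; ∙-cong)

  private
    variable
      I J K L : Set ℓ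
      a b c : Carrier

  -- Order and residuation in the lattice.

  ≈⇒≥ : a ≈ b → b ≤ a
  ≈⇒≥ a≈b = ≈⇒≤ (Eq.sym a≈b)

  -- The Yoneda principle for a poset. Infima and residua are known by what lies below them, so
  -- equations between them become equivalences of inequalities.
  ≈-fromLowerBounds : (∀ c → c ≤ a ⇔ c ≤ b) → a ≈ b
  ≈-fromLowerBounds eqv = antisym (to (eqv _) ≤-refl) (from (eqv _) ≤-refl)

  ≈-fromUpperBounds : (∀ c → a ≤ c ⇔ b ≤ c) → a ≈ b
  ≈-fromUpperBounds eqv = antisym (from (eqv _) ≤-refl) (to (eqv _) ≤-refl)

  ⇨-intro : a · b ≤ c → a ≤ b ⇨ c
  ⇨-intro = proj₁ (residuation _ _ _)

  ⇨-elim : a ≤ b ⇨ c → a · b ≤ c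
  ⇨-elim = proj₂ (residuation _ _ _)

  ·-comm-≤ : a · b ≤ c → b · a ≤ c
  ·-comm-≤ = trans (≈⇒≤ (comm _ _))

  ·-swapʳ : ∀ a b c → (a · b) · c ≈ (a · c) · b
  ·-swapʳ a b c = Eq.trans (assoc a b c)
    (Eq.trans (∙-cong Eq.refl (comm b c)) (Eq.sym (assoc a c b)))

  ≤⇒1≤⇨ : a ≤ b → 1# ≤ a ⇨ b
  ≤⇒1≤⇨ a≤b = ⇨-intro (trans (≈⇒≤ (identityˡ _)) a≤b)

  1≤⇨⇒≤ : 1# ≤ a ⇨ b → a ≤ b
  1≤⇨⇒≤ 1≤a⇨b = trans (≈⇒≥ (identityˡ _)) (⇨-elim 1≤a⇨b)

  -- Universal properties of suprema and infima.

  ≤⋀[] : {f : K → Carrier} → a ≤ ⋀[] f ⇔ (∀ k → a ≤ f k)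
  ≤⋀[] = mk⇔
    (λ a≤⋀ k → trans a≤⋀ (proj₁ (⋀-isInfimum _) _ (k , Eq.refl)))
    (λ a≤f → proj₂ (⋀-isInfimum _) _ λ { _ (k , fk≈b) → trans (a≤f k) (≈⇒≤ fk≈b) })

  ⋁[]≤ : {f : K → Carrier} → ⋁[] f ≤ a ⇔ (∀ k → f k ≤ a)
  ⋁[]≤ = mk⇔
    (λ ⋁≤a k → trans (proj₁ (⋁-isSupremum _) _ (k , Eq.refl)) ⋁≤a)
    (λ f≤a → proj₂ (⋁-isSupremum _) _ λ { _ (k , fk≈b) → trans (≈⇒≥ fk≈b) (f≤a k) })

  ≤⋀̇ : {M : Pred (K → Carrier) ℓ} {k : K} →
    a ≤ ⋀̇ M k ⇔ (∀ x → x ∈ M → a ≤ x k)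
  ≤⋀̇ = mk⇔
    (λ a≤⋀ x x∈M → trans a≤⋀ (proj₁ (⋀-isInfimum _) _ (x , x∈M , Eq.refl)))
    (λ a≤M → proj₂ (⋀-isInfimum _) _
      λ { _ (x , x∈M , xk≈b) → trans (a≤M x x∈M) (≈⇒≤ xk≈b) })

  ⋁̇≤ : {M : Pred (K → Carrier) ℓ} {k : K} →
    ⋁̇ M k ≤ a ⇔ (∀ x → x ∈ M → x k ≤ a)
  ⋁̇≤ = mk⇔
    (λ ⋁≤a x x∈M → trans (proj₁ (⋁-isSupremum _) _ (x , x∈M , Eq.refl)) ⋁≤a)
    (λ M≤a → proj₂ (⋁-isSupremum _) _
      λ { _ (x , x∈M , xk≈b) → trans (≈⇒≥ xk≈b) (M≤a x x∈M) })

  ≤⋀̇-image : (f : Mapping K L) {M : Pred (K → Carrier) ℓ} {l : L} →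
    a ≤ ⋀̇ (image f M) l ⇔ (∀ x → x ∈ M → a ≤ (f ⟨$⟩ x) l)
  ≤⋀̇-image f {l = l} = mk⇔
    (λ a≤⋀ x x∈M → to ≤⋀̇ a≤⋀ (f ⟨$⟩ x) (x , x∈M , λ _ → Eq.refl))
    (λ a≤f → from ≤⋀̇ λ { _ (x , x∈M , fx≈y) → trans (a≤f x x∈M) (≈⇒≤ (fx≈y l)) })

  ⋁̇-image≤ : (f : Mapping K L) {M : Pred (K → Carrier) ℓ} {l : L} →
    ⋁̇ (image f M) l ≤ a ⇔ (∀ x → x ∈ M → (f ⟨$⟩ x) l ≤ a)
  ⋁̇-image≤ f {l = l} = mk⇔
    (λ ⋁≤a x x∈M → to ⋁̇≤ ⋁≤a (f ⟨$⟩ x) (x , x∈M , λ _ → Eq.refl))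
    (λ f≤a → from ⋁̇≤ λ { _ (x , x∈M , fx≈y) → trans (≈⇒≥ (fx≈y l)) (f≤a x x∈M) })

  -- Serves to derive monotonicity from preservation of infima: anything above `x` is a member of
  -- the set whose infimum is `x`.
  ⋀̇-upSet : (x : K → Carrier) → ⋀̇ (x ≤̇_) ≈̇ x
  ⋀̇-upSet x k = antisym (to ≤⋀̇ ≤-refl x (λ _ → ≤-refl)) (from ≤⋀̇ λ _ x≤z → x≤z k)

  ⋁̇-downSet : (x : K → Carrier) → ⋁̇ (_≤̇ x) ≈̇ x
  ⋁̇-downSet x k = antisym (from ⋁̇≤ λ _ z≤x → z≤x k) (to ⋁̇≤ ≤-refl x (λ _ → ≤-refl))

  -- Operators of a fuzzy relation and their adjunctions.

  ≤φ[] : (R : FuzzyRelation I J) {x : I → Carrier} {j : J} →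
    a ≤ φ[ R ] x j ⇔ (∀ i → a · R i j ≤ x i)
  ≤φ[] R = mk⇔ (λ p i → ⇨-elim (to ≤⋀[] p i)) (λ p → from ≤⋀[] λ i → ⇨-intro (p i))

  ρ[]≤ : (R : FuzzyRelation I J) {y : J → Carrier} {i : I} →
    ρ[ R ] y i ≤ a ⇔ (∀ j → R i j · y j ≤ a)
  ρ[]≤ R = ⋁[]≤

  ≤δ[] : (R : FuzzyRelation I J) {x : I → Carrier} {j : J} →
    a ≤ δ[ R ] x j ⇔ (∀ i → a · x i ≤ R i j)
  ≤δ[] R = mk⇔ (λ p i → ⇨-elim (to ≤⋀[] p i)) (λ p → from ≤⋀[] λ i → ⇨-intro (p i))

  -- Up to commutativity, both sides say `y j · R i j ≤ x i` for all `i` and `j`.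
  φ[]-adjoint : (R : FuzzyRelation I J) {x : I → Carrier} {y : J → Carrier} →
    y ≤̇ φ[ R ] x ⇔ ρ[ R ] y ≤̇ x
  φ[]-adjoint R = mk⇔
    (λ p i → from (ρ[]≤ R) λ j → ·-comm-≤ (to (≤φ[] R) (p j) i))
    (λ p j → from (≤φ[] R) λ i → ·-comm-≤ (to (ρ[]≤ R) (p i) j))

  -- Both sides say `y j · x i ≤ R i j`. As `ε[ R ]` unfolds to `δ[ flip R ]`, the bound `≤δ[]`
  -- serves for both operators.
  δ[]-adjoint : (R : FuzzyRelation I J) {x : I → Carrier} {y : J → Carrier} →
    y ≤̇ δ[ R ] x ⇔ x ≤̇ ε[ R ] y
  δ[]-adjoint R = mk⇔
    (λ p i → from (≤δ[] (flip R)) λ j → ·-comm-≤ (to (≤δ[] R) (p j) i))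
    (λ p j → from (≤δ[] R) λ i → ·-comm-≤ (to (≤δ[] (flip R)) (p i) j))

  -- Operators of a relation have the required types.

  module _ (φ : Mapping I J) (R : FuzzyRelation I J) (φ≐ : φ ≐ φ[ R ]) where

    private
      ≤φ : ∀ {x j} → a ≤ (φ ⟨$⟩ x) j ⇔ (∀ i → a · R i j ≤ x i)
      ≤φ = mk⇔ (λ p → to (≤φ[] R) (trans p (≈⇒≤ (φ≐ _ _))))
               (λ p → trans (from (≤φ[] R) p) (≈⇒≥ (φ≐ _ _)))

    -- Under `≤φ`, an infimum commutes with the quantifier over `i`, and a constant crosses by
    -- swapping two factors.
    φ[]⇒Isφ-Type : Isφ-Type φ
    φ[]⇒Isφ-Type = record
      { preserves-⋀ = λ M j → ≈-fromLowerBounds λ a → mk⇔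
          (λ p → from (≤⋀̇-image φ) λ x x∈M → from ≤φ λ i → to ≤⋀̇ (to ≤φ p i) x x∈M)
          (λ p → from ≤φ λ i → from ≤⋀̇ λ x x∈M → to ≤φ (to (≤⋀̇-image φ) p x x∈M) i)
      ; commutes-⇨ = λ d x j → ≈-fromLowerBounds λ a → mk⇔
          (λ p → from ≤φ λ i → ⇨-intro (trans (≈⇒≤ (·-swapʳ _ _ _)) (to ≤φ (⇨-elim p) i)))
          (λ p → ⇨-intro (from ≤φ λ i → trans (≈⇒≤ (·-swapʳ _ _ _)) (⇨-elim (to ≤φ p i))))
      }

  module _ (ρ : Mapping J I) (R : FuzzyRelation I J) (ρ≐ : ρ ≐ ρ[ R ]) where

    private
      ρ≤ : ∀ {y i} → (ρ ⟨$⟩ y) i ≤ a ⇔ (∀ j → R i j · y j ≤ a)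
      ρ≤ = mk⇔ (λ p → to (ρ[]≤ R) (trans (≈⇒≥ (ρ≐ _ _)) p))
               (λ p → trans (≈⇒≤ (ρ≐ _ _)) (from (ρ[]≤ R) p))

    ρ[]⇒Isρ-Type : Isρ-Type ρ
    ρ[]⇒Isρ-Type = record
      { preserves-⋁ = λ M i → ≈-fromUpperBounds λ a → mk⇔
          -- The supremum occurs inside a product, so residuation moves the factor `R i j` to the
          -- right before `⋁̇≤` applies, and back afterwards.
          (λ p → from (⋁̇-image≤ ρ) λ y y∈M → from ρ≤ λ j →
            ·-comm-≤ (⇨-elim (to ⋁̇≤ (⇨-intro (·-comm-≤ (to ρ≤ p j))) y y∈M)))
          (λ p → from ρ≤ λ j → ·-comm-≤ (⇨-elim (from ⋁̇≤ λ y y∈M →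
            ⇨-intro (·-comm-≤ (to ρ≤ (to (⋁̇-image≤ ρ) p y y∈M) j)))))
      ; commutes-· = λ d y i → ≈-fromUpperBounds λ a → mk⇔
          -- Here residuation moves `d` into the bound, so that `ρ≤` is used with bound `d ⇨ a`.
          (λ p → from ρ≤ λ j → trans (≈⇒≤ (rotate (R i j) d (y j)))
            (⇨-elim (to ρ≤ (⇨-intro (·-comm-≤ p)) j)))
          (λ p → ·-comm-≤ (⇨-elim (from ρ≤ λ j →
            ⇨-intro (trans (≈⇒≥ (rotate (R i j) d (y j))) (to ρ≤ p j)))))
      }
      where
      rotate : ∀ a b c → a · (b · c) ≈ (a · c) · b
      rotate a b c = Eq.trans (Eq.sym (assoc a b c)) (·-swapʳ a b c)

  module _ (δ : Mapping I J) (R : FuzzyRelation I J) (δ≐ : δ ≐ δ[ R ]) where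

    private
      ≤δ : ∀ {x j} → a ≤ (δ ⟨$⟩ x) j ⇔ (∀ i → a · x i ≤ R i j)
      ≤δ = mk⇔ (λ p → to (≤δ[] R) (trans p (≈⇒≤ (δ≐ _ _))))
               (λ p → trans (from (≤δ[] R) p) (≈⇒≥ (δ≐ _ _)))

    δ[]⇒Isδ-Type : Isδ-Type δ
    δ[]⇒Isδ-Type = record
      { reverses-⋁ = λ M j → ≈-fromLowerBounds λ a → mk⇔
          (λ p → from (≤⋀̇-image δ) λ x x∈M → from ≤δ λ i →
            ·-comm-≤ (⇨-elim (to ⋁̇≤ (⇨-intro (·-comm-≤ (to ≤δ p i))) x x∈M)))
          (λ p → from ≤δ λ i → ·-comm-≤ (⇨-elim (from ⋁̇≤ λ x x∈M →
            ⇨-intro (·-comm-≤ (to ≤δ (to (≤⋀̇-image δ) p x x∈M) i)))))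
      ; exchanges = λ d x j → ≈-fromLowerBounds λ a → mk⇔
          (λ p → from ≤δ λ i → trans (≈⇒≥ (assoc _ _ _)) (to ≤δ (⇨-elim p) i))
          (λ p → ⇨-intro (from ≤δ λ i → trans (≈⇒≤ (assoc _ _ _)) (to ≤δ p i)))
      }

  -- Relations representing given mappings.

  module _ (φ : Mapping I J) (φ-type : Isφ-Type φ) where
    open Isφ-Type φ-type

    φ-type-monotone : Monotonic₁ _≤̇_ _≤̇_ (φ ⟨$⟩_)
    φ-type-monotone {x} {x′} x≤x′ j = trans
      (≈⇒≥ (Eq.trans (Eq.sym (preserves-⋀ (x ≤̇_) j)) (Func.cong φ (⋀̇-upSet x) j)))
      (to (≤⋀̇-image φ) ≤-refl x′ x≤x′)

    φ-relation : FuzzyRelation I J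
    φ-relation i j = ⋀̇ (λ x → 1# ≤ (φ ⟨$⟩ x) j) i

    -- Preservation of infima puts the infimum defining the column into its own set, so the least
    -- element is attained.
    1≤φ-column : ∀ j → 1# ≤ (φ ⟨$⟩ flip φ-relation j) j
    1≤φ-column j = trans (from (≤⋀̇-image φ) λ _ 1≤φx → 1≤φx) (≈⇒≥ (preserves-⋀ _ j))

    φ≐φ[] : φ ≐ φ[ φ-relation ]
    φ≐φ[] x j = antisym
      -- With `d = (φ ⟨$⟩ x) j`, the element `const d ⇨̇ x` belongs to the set defining column `j`,
      -- hence lies above the column.
      (from (≤φ[] φ-relation) λ i → ·-comm-≤ (⇨-elim
        (to ≤⋀̇ ≤-refl _ (trans (≤⇒1≤⇨ ≤-refl) (≈⇒≤ (commutes-⇨ _ x j))))))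
      -- With `d = φ[ φ-relation ] x j`, column `j` lies below `const d ⇨̇ x`, and monotonicity
      -- carries `1#` over.
      (1≤⇨⇒≤ (trans (1≤φ-column j) (trans
        (φ-type-monotone (λ i → ⇨-intro (·-comm-≤ (to (≤φ[] φ-relation) ≤-refl i))) j)
        (≈⇒≥ (commutes-⇨ _ x j)))))

  module _ (δ : Mapping I J) (δ-type : Isδ-Type δ) where
    open Isδ-Type δ-type

    δ-type-antitone : Antitonic₁ _≤̇_ _≤̇_ (δ ⟨$⟩_)
    δ-type-antitone {x} {x′} x′≤x j = trans
      (≈⇒≥ (Eq.trans (Eq.sym (reverses-⋁ (_≤̇ x) j)) (Func.cong δ (⋁̇-downSet x) j)))
      (to (≤⋀̇-image δ) ≤-refl x′ x′≤x)

    δ-relation : FuzzyRelation I J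
    δ-relation i j = ⋁̇ (λ x → 1# ≤ (δ ⟨$⟩ x) j) i

    1≤δ-column : ∀ j → 1# ≤ (δ ⟨$⟩ flip δ-relation j) j
    1≤δ-column j = trans (from (≤⋀̇-image δ) λ _ 1≤δx → 1≤δx) (≈⇒≥ (reverses-⋁ _ j))

    δ≐δ[] : δ ≐ δ[ δ-relation ]
    δ≐δ[] x j = antisym
      -- Dually, for `d = (δ ⟨$⟩ x) j` the element `const d ·̇ x` lies below the greatest element,
      -- column `j`.
      (from (≤δ[] δ-relation) λ i →
        to ⋁̇≤ ≤-refl _ (trans (≤⇒1≤⇨ ≤-refl) (≈⇒≤ (exchanges _ x j))))
      (1≤⇨⇒≤ (trans (1≤δ-column j) (trans
        (δ-type-antitone (to (≤δ[] δ-relation) ≤-refl) j)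
        (≈⇒≥ (exchanges _ x j)))))

  -- Equality on J need not be decidable, so the characteristic function of {j}
  -- is a supremum of a subset of {1} instead of a case distinction.
  singleton : J → (J → Carrier)
  singleton j j′ = ⋁ (λ a → j ≡ j′ × 1# ≈ a)

  1≤singleton : (j : J) → 1# ≤ singleton j j
  1≤singleton j = proj₁ (⋁-isSupremum _) 1# (refl , Eq.refl)

  multiples : (J → Carrier) → Pred (J → Carrier) _
  multiples y z = ∃ λ j → z ≈̇ const (y j) ·̇ singleton j

  ⋁̇-multiples : (y : J → Carrier) → ⋁̇ (multiples y) ≈̇ y
  ⋁̇-multiples y j = antisym
    -- After residuation the claim is `singleton k j ≤ y k ⇨ y j`. A member of the set defining
    -- `singleton k j` brings `k ≡ j`, which leaves `1# ≤ y j ⇨ y j`.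
    (from ⋁̇≤ λ { z (k , z≈) → trans (≈⇒≤ (z≈ j)) (·-comm-≤ (⇨-elim
      (proj₂ (⋁-isSupremum _) _ λ { _ (refl , 1≈a) → trans (≈⇒≥ 1≈a) (≤⇒1≤⇨ ≤-refl) }))) })
    -- The multiple belonging to `j` already reaches `y j` at `j`, because `1# ≤ singleton j j`.
    (trans (≈⇒≥ (identityˡ _)) (⇨-elim (trans (1≤singleton j) (⇨-intro
      (·-comm-≤ (to ⋁̇≤ ≤-refl (const (y j) ·̇ singleton j) (j , λ _ → Eq.refl)))))))

  module _ (ρ : Mapping J I) (ρ-type : Isρ-Type ρ) where
    open Isρ-Type ρ-type

    ρ-type-monotone : Monotonic₁ _≤̇_ _≤̇_ (ρ ⟨$⟩_)
    ρ-type-monotone {y} {y′} y≤y′ i = trans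
      (to (⋁̇-image≤ ρ) ≤-refl y y≤y′)
      (≈⇒≤ (Eq.trans (Eq.sym (preserves-⋁ (_≤̇ y′) i)) (Func.cong ρ (⋁̇-downSet y′) i)))

    ρ-relation : FuzzyRelation I J
    ρ-relation i j = (ρ ⟨$⟩ singleton j) i

    ρ-multiple : ∀ j b i → (ρ ⟨$⟩ (const b ·̇ singleton j)) i ≈ ρ-relation i j · b
    ρ-multiple j b i = Eq.trans (Eq.sym (commutes-· b (singleton j) i)) (comm _ _)

    ρ≐ρ[] : ρ ≐ ρ[ ρ-relation ]
    ρ≐ρ[] y i = Eq.trans (Func.cong ρ (λ j → Eq.sym (⋁̇-multiples y j)) i)
      (Eq.trans (preserves-⋁ (multiples y) i) (≈-fromUpperBounds λ a → mk⇔
        (λ p → from (ρ[]≤ ρ-relation) λ j → trans (≈⇒≥ (ρ-multiple j (y j) i))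
          (to (⋁̇-image≤ ρ) p (const (y j) ·̇ singleton j) (j , λ _ → Eq.refl)))
        (λ p → from (⋁̇-image≤ ρ) λ { z (j , z≈) → trans
          (≈⇒≤ (Eq.trans (Func.cong ρ z≈ i) (ρ-multiple j (y j) i)))
          (to (ρ[]≤ ρ-relation) p j) })))

  -- Galois connections and reversed Galois connections.

  module _ (φ : Mapping I J) (ρ : Mapping J I) where

    -- Uniqueness of left adjoints: each inequality transposes the unit of one adjunction along the
    -- other.
    leftAdjoint≐ρ[] : (R : FuzzyRelation I J) → φ ≐ φ[ R ] →
      IsGaloisConnection φ ρ → ρ ≐ ρ[ R ]
    leftAdjoint≐ρ[] R φ≐ gc y i = antisym
      (to (adjoint (ρ[ R ] y) y)
        (λ j → trans (from (φ[]-adjoint R) (λ _ → ≤-refl) j) (≈⇒≥ (φ≐ _ j))) i)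
      (to (φ[]-adjoint R)
        (λ j → trans (from (adjoint (ρ ⟨$⟩ y) y) (λ _ → ≤-refl) j) (≈⇒≤ (φ≐ _ j))) i)
      where open IsGaloisConnection gc

    sameRelation⇒galois : (R : FuzzyRelation I J) → φ ≐ φ[ R ] → ρ ≐ ρ[ R ] →
      ∀ x y → y ≤̇ φ ⟨$⟩ x ⇔ ρ ⟨$⟩ y ≤̇ x
    sameRelation⇒galois R φ≐ ρ≐ x y = mk⇔
      (λ p i → trans (≈⇒≤ (ρ≐ y i))
        (to (φ[]-adjoint R) (λ j → trans (p j) (≈⇒≤ (φ≐ x j))) i))
      (λ p j → trans
        (from (φ[]-adjoint R) (λ i → trans (≈⇒≥ (ρ≐ y i)) (p i)) j) (≈⇒≥ (φ≐ x j)))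

    galois⇔sameRelation : Isφ-Type φ → Isρ-Type ρ →
      IsGaloisConnection φ ρ ⇔ (∃ λ R → (φ ≐ φ[ R ]) × (ρ ≐ ρ[ R ]))
    galois⇔sameRelation φ-type ρ-type = mk⇔
      -- The relation is read off `φ`; the connection then forces `ρ` to be its partner.
      (λ gc → φ-relation φ φ-type , φ≐φ[] φ φ-type ,
        leftAdjoint≐ρ[] _ (φ≐φ[] φ φ-type) gc)
      (λ { (R , φ≐ , ρ≐) → record
        { φ-monotone = φ-type-monotone φ φ-type
        ; ρ-monotone = ρ-type-monotone ρ ρ-type
        ; adjoint    = sameRelation⇒galois R φ≐ ρ≐
        } })

  module _ (δ : Mapping I J) (ε : Mapping J I) where

    reversedAdjoint≐ε[] : (R : FuzzyRelation I J) → δ ≐ δ[ R ] →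
      IsReversedGaloisConnection δ ε → ε ≐ ε[ R ]
    reversedAdjoint≐ε[] R δ≐ gc y i = antisym
      (to (δ[]-adjoint R)
        (λ j → trans (from (adjoint (ε ⟨$⟩ y) y) (λ _ → ≤-refl) j) (≈⇒≤ (δ≐ _ j))) i)
      (to (adjoint (ε[ R ] y) y)
        (λ j → trans (from (δ[]-adjoint R) (λ _ → ≤-refl) j) (≈⇒≥ (δ≐ _ j))) i)
      where open IsReversedGaloisConnection gc

    sameRelation⇒reversedGalois : (R : FuzzyRelation I J) → δ ≐ δ[ R ] → ε ≐ ε[ R ] →
      ∀ x y → y ≤̇ δ ⟨$⟩ x ⇔ x ≤̇ ε ⟨$⟩ y
    sameRelation⇒reversedGalois R δ≐ ε≐ x y = mk⇔
      (λ p i → trans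
        (to (δ[]-adjoint R) (λ j → trans (p j) (≈⇒≤ (δ≐ x j))) i) (≈⇒≥ (ε≐ y i)))
      (λ p j → trans
        (from (δ[]-adjoint R) (λ i → trans (p i) (≈⇒≤ (ε≐ y i))) j) (≈⇒≥ (δ≐ x j)))

    reversedGalois⇔sameRelation : Isδ-Type δ → Isδ-Type ε →
      IsReversedGaloisConnection δ ε ⇔ (∃ λ R → (δ ≐ δ[ R ]) × (ε ≐ ε[ R ]))
    reversedGalois⇔sameRelation δ-type ε-type = mk⇔
      (λ gc → δ-relation δ δ-type , δ≐δ[] δ δ-type ,
        reversedAdjoint≐ε[] _ (δ≐δ[] δ δ-type) gc)
      (λ { (R , δ≐ , ε≐) → record
        { δ-antitone = δ-type-antitone δ δ-type
        ; ε-antitone = δ-type-antitone ε ε-type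
        ; adjoint    = sameRelation⇒reversedGalois R δ≐ ε≐
        } })

theorem3 : ∀ {ℓ} (𝐀 : CompleteResiduatedLattice ℓ) (I J : Set ℓ) →
    let open FuzzyRelations 𝐀 in
    ( (∀ (φ : Mapping I J) →
    Isφ-Type φ ⇔ (∃ λ (R : FuzzyRelation I J) → φ ≐ φ[ R ]))
    × (∀ (ρ : Mapping J I) →
    Isρ-Type ρ ⇔ (∃ λ (R : FuzzyRelation I J) → ρ ≐ ρ[ R ]))
    × (∀ (φ : Mapping I J) (ρ : Mapping J I) → Isφ-Type φ → Isρ-Type ρ →
    IsGaloisConnection φ ρ
    ⇔ (∃ λ (R : FuzzyRelation I J) → (φ ≐ φ[ R ]) × (ρ ≐ ρ[ R ]))) )
    ×
    ( (∀ (δ : Mapping I J) →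
    Isδ-Type δ ⇔ (∃ λ (R : FuzzyRelation I J) → δ ≐ δ[ R ]))
    × (∀ (ε : Mapping J I) →
    Isδ-Type ε ⇔ (∃ λ (R : FuzzyRelation I J) → ε ≐ ε[ R ]))
    × (∀ (δ : Mapping I J) (ε : Mapping J I) → Isδ-Type δ → Isδ-Type ε →
    IsReversedGaloisConnection δ ε
    ⇔ (∃ λ (R : FuzzyRelation I J) → (δ ≐ δ[ R ]) × (ε ≐ ε[ R ]))) )
theorem3 𝐀 I J =
    ( (λ φ → mk⇔ (λ t → φ-relation φ t , φ≐φ[] φ t) (λ { (R , φ≐) → φ[]⇒Isφ-Type φ R φ≐ }))
    , (λ ρ → mk⇔ (λ t → ρ-relation ρ t , ρ≐ρ[] ρ t) (λ { (R , ρ≐) → ρ[]⇒Isρ-Type ρ R ρ≐ }))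
    , galois⇔sameRelation )
  , ( (λ δ → mk⇔ (λ t → δ-relation δ t , δ≐δ[] δ t) (λ { (R , δ≐) → δ[]⇒Isδ-Type δ R δ≐ }))
    -- `δ-relation ε t` is indexed by `J` and then `I`; `flip` turns it into a relation between `I`
    -- and `J`, and `ε[ flip S ]` is `δ[ S ]` by definition.
    , (λ ε → mk⇔ (λ t → flip (δ-relation ε t) , δ≐δ[] ε t)
        (λ { (R , ε≐) → δ[]⇒Isδ-Type ε (flip R) ε≐ }))
    , reversedGalois⇔sameRelation )
  where open Representation 𝐀
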